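{- Let $K$ be a positive integer, and let $(a(n))_{n\ge 1}$ be the sequence of rational numbers defined by the initial conditions $a(m)=1$ for $1\le m\le 2K+1$ and, for all $n\ge 2K+2$, by the recurrence $$a(n)\,a(n-(2K+1)) = a(n-1)\,a(n-2K)+a(n-K)+a(n-K-1).$$ Then $a(n)$ is an integer for every $n\ge 1$.
   Context: The recurrence determines $a(n)$ by dividing by $a(n-(2K+1))$, i.e. $a(n)=\bigl(a(n-1)a(n-2K)+a(n-K)+a(n-K-1)\bigr)/a(n-(2K+1))$. -}

module Defs where

open import Data.Nat using (ℕ; _≤_; _∸_)
import Data.Nat as ℕ
open import Data.Rational using (ℚ; 1ℚ; _+_; _*_)
open import Relation.Binary.PropositionalEquality using (_≡_)

-- A sequence (a(n))_{n ≥ 1} is a function on ℕ whose value at 0 is left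
-- unconstrained.  In `recurrence` the truncated subtractions are exact and all
-- indices are at least 1, because n ≥ 2K+2.  All terms of such a sequence are
-- positive, so the product form amounts to division by a(n-(2K+1)) and
-- determines a(n) for every n ≥ 1.
record IsRecurrenceSequence (K : ℕ) (a : ℕ → ℚ) : Set where
  field
    initial    : ∀ m → 1 ≤ m → m ≤ 2 ℕ.* K ℕ.+ 1 → a m ≡ 1ℚ
    recurrence : ∀ n → 2 ℕ.* K ℕ.+ 2 ≤ n →
                 a n * a (n ∸ (2 ℕ.* K ℕ.+ 1))
                   ≡ a (n ∸ 1) * a (n ∸ 2 ℕ.* K) + a (n ∸ K) + a (n ∸ K ∸ 1)

{-# OPTIONS --safe #-}

-- The sequence satisfies a linear recurrence with integer coefficients. Put
--   B(n) = (a(n) a(n+3K) + a(n+K) a(n+4K) + 1) / a(n+2K).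
-- The quadratic relations at n, n+K, n+2K and n+3K imply that
--   c = (a(n+5K) + B(n)) / a(n+3K)
-- is independent of n; comparing the numerators of B(n) and B(n+K) then gives
-- a(n) + B(n+K) = c a(n+2K), and eliminating B yields
--   a(n+6K) = c (a(n+4K) - a(n+2K)) + a(n).
-- The relation is invariant under reversing the order of the terms, so the
-- sequence extends to the left as a palindrome about its block of 2K+1 ones.
-- A window of 6K+1 terms centred at that block consists of integers, because
-- only divisions by 1 occur in it, and it also shows that c is an integer.
module Submission where

open import Defs
open import Data.Nat using (ℕ; _≤_)
open import Data.Rational using (ℚ; _/_)
open import Data.Product using (∃-syntax)
open import Relation.Binary.PropositionalEquality using (_≡_)

open import Data.Nat using (zero; suc; z≤n; s≤s; _<_; _∸_; ∣_-_∣)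
import Data.Nat as ℕ
import Data.Nat.Properties as ℕ
open import Data.Nat.Induction using (<-rec)
import Data.Nat.Tactic.RingSolver as ℕ-Solver
open import Data.Integer using (+_)
import Data.Integer as ℤ
import Data.Integer.Properties as ℤ
open import Data.Product using (_,_)
open import Data.Sum using (inj₁; inj₂)
open import Data.Rational using (0ℚ; 1ℚ; _+_; _*_; -_; 1/_; Positive; NonZero; toℚᵘ; positive)
open import Data.Rational.Properties
import Data.Rational.Unnormalised as ℚᵘ
import Data.Rational.Unnormalised.Properties as ℚᵘ
open import Function using (_∘_)
open import Level using (0ℓ)
open import Relation.Binary.PropositionalEquality
  using (refl; sym; trans; cong; cong₂; subst; module ≡-Reasoning)
open import Relation.Nullary using (yes; no)
open import Relation.Nullary.Decidable using (dec⇒maybe)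
open import Tactic.RingSolver using (solve-∀)
open import Tactic.RingSolver.Core.AlmostCommutativeRing
  using (AlmostCommutativeRing; fromCommutativeRing)

-- Ring identities and cancellation over the rationals.

ℚ-ring : AlmostCommutativeRing 0ℓ 0ℓ
ℚ-ring = fromCommutativeRing +-*-commutativeRing (λ q → dec⇒maybe (0ℚ ≟ q))

-- Proves x ≡ y as a linear combination u ≡ v of known equations, leaving a ring
-- identity to the solver; negative coefficients are handled by swapping sides.
+-cancel-≡ : ∀ {x y u v : ℚ} → u ≡ v → x + u ≡ y + v → x ≡ y
+-cancel-≡ {x} {y} {u} refl eq = +-cancelʳ u x y eq
  where open import Algebra.Properties.Group +-0-group renaming (∙-cancelʳ to +-cancelʳ)

*-cancelʳ-pos : ∀ {p q} r → Positive r → p * r ≡ q * r → p ≡ q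
*-cancelʳ-pos r r>0 eq = ≤-antisym
  (*-cancelʳ-≤-pos r {{r>0}} (≤-reflexive eq))
  (*-cancelʳ-≤-pos r {{r>0}} (≤-reflexive (sym eq)))

pos-*-cancelʳ : ∀ p q → Positive q → Positive (p * q) → Positive p
pos-*-cancelʳ p q q>0 pq>0 = positive (*-cancelʳ-<-nonNeg q {{pos⇒nonNeg q {{q>0}}}} {0ℚ} {p}
  (subst (Data.Rational._< p * q) (sym (*-zeroˡ q)) (positive⁻¹ (p * q) {{pq>0}})))

-- Integral rationals and their closure under ring operations.

Integral : ℚ → Set
Integral q = ∃[ z ] q ≡ z / 1

-- Normalisation keeps `i / 1` from computing on a variable `i`. Unnormalised fractions with
-- denominator 1 do compute, so sums and products are compared there.
toℚᵘ-/1 : ∀ i → toℚᵘ (i / 1) ℚᵘ.≃ ℚᵘ.mkℚᵘ i 0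
toℚᵘ-/1 i = toℚᵘ-fromℚᵘ (ℚᵘ.mkℚᵘ i 0)

integral-1 : Integral 1ℚ
integral-1 = + 1 , refl

integral-+ : ∀ {p q} → Integral p → Integral q → Integral (p + q)
integral-+ (i , refl) (j , refl) = i ℤ.+ j , toℚᵘ-injective (begin
  toℚᵘ (i / 1 + j / 1)                  ≈⟨ toℚᵘ-homo-+ (i / 1) (j / 1) ⟩
  toℚᵘ (i / 1) ℚᵘ.+ toℚᵘ (j / 1)        ≈⟨ ℚᵘ.+-cong (toℚᵘ-/1 i) (toℚᵘ-/1 j) ⟩
  ℚᵘ.mkℚᵘ i 0 ℚᵘ.+ ℚᵘ.mkℚᵘ j 0          ≡⟨ cong₂ (λ k l → ℚᵘ.mkℚᵘ (k ℤ.+ l) 0) (ℤ.*-identityʳ i) (ℤ.*-identityʳ j) ⟩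
  ℚᵘ.mkℚᵘ (i ℤ.+ j) 0                   ≈⟨ toℚᵘ-/1 (i ℤ.+ j) ⟨
  toℚᵘ ((i ℤ.+ j) / 1)                  ∎)
  where open import Relation.Binary.Reasoning.Setoid ℚᵘ.≃-setoid

integral-* : ∀ {p q} → Integral p → Integral q → Integral (p * q)
integral-* (i , refl) (j , refl) = i ℤ.* j , toℚᵘ-injective (begin
  toℚᵘ (i / 1 * (j / 1))                ≈⟨ toℚᵘ-homo-* (i / 1) (j / 1) ⟩
  toℚᵘ (i / 1) ℚᵘ.* toℚᵘ (j / 1)        ≈⟨ ℚᵘ.*-cong (toℚᵘ-/1 i) (toℚᵘ-/1 j) ⟩
  ℚᵘ.mkℚᵘ (i ℤ.* j) 0                   ≈⟨ toℚᵘ-/1 (i ℤ.* j) ⟨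
  toℚᵘ ((i ℤ.* j) / 1)                  ∎)
  where open import Relation.Binary.Reasoning.Setoid ℚᵘ.≃-setoid

integral-neg : ∀ {p} → Integral p → Integral (- p)
integral-neg {p} p∈ℤ = subst Integral (lemma p) (integral-* (ℤ.- (+ 1) , refl) p∈ℤ)
  where
  lemma : ∀ p → (- 1ℚ) * p ≡ - p
  lemma = solve-∀ ℚ-ring

-- Wronskian-type consequences of the quadratic relations.

-- Unprimed variables a₀, a₁, … stand for the terms y(n), y(n+K), …, and
-- primed ones for y(n+1), y(n+K+1), …; likewise b = B(n) and b′ = B(n+1).
module _ {a₀ a₀′ a₁ a₁′ a₂ a₂′ a₃ a₃′ a₄ a₄′ : ℚ}
  (e₀ : a₂′ * a₀ ≡ a₂ * a₀′ + a₁′ + a₁)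
  (e₁ : a₃′ * a₁ ≡ a₃ * a₁′ + a₂′ + a₂)
  (e₂ : a₄′ * a₂ ≡ a₄ * a₂′ + a₃′ + a₃)
  where

  -- This is the combination `a₃′ e₀ - a₁′ e₂ + e₁`, in which the products `a₁ a₃′`, `a₁′ a₃` and
  -- `a₁′ a₃′` cancel.
  ratio-cross : (a₀ * a₃′ + a₄ * a₁′) * a₂′ ≡ (a₀′ * a₃′ + a₁′ * a₄′ + 1ℚ) * a₂ + a₂′
  ratio-cross = +-cancel-≡
    (cong₂ _+_ (cong₂ _+_ (cong (a₃′ *_) (sym e₀)) (cong (a₁′ *_) e₂)) (sym e₁))
    (identity a₀ a₀′ a₁ a₁′ a₂ a₂′ a₃ a₃′ a₄ a₄′)
    where
    identity : ∀ a₀ a₀′ a₁ a₁′ a₂ a₂′ a₃ a₃′ a₄ a₄′ →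
      (a₀ * a₃′ + a₄ * a₁′) * a₂′
        + (a₃′ * (a₂ * a₀′ + a₁′ + a₁) + a₁′ * (a₄′ * a₂) + (a₃ * a₁′ + a₂′ + a₂))
      ≡ (a₀′ * a₃′ + a₁′ * a₄′ + 1ℚ) * a₂ + a₂′
        + (a₃′ * (a₂′ * a₀) + a₁′ * (a₄ * a₂′ + a₃′ + a₃) + a₃′ * a₁)
    identity = solve-∀ ℚ-ring

  module _ {b b′ : ℚ} (a₂>0 : Positive a₂) (a₂′>0 : Positive a₂′)
    (b-def  : b  * a₂  ≡ a₀  * a₃  + a₁  * a₄  + 1ℚ)
    (b′-def : b′ * a₂′ ≡ a₀′ * a₃′ + a₁′ * a₄′ + 1ℚ)
    where

    -- Although `b′` is a quotient by `a₂′`, its product with `a₂` is polynomial in the terms;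
    -- multiplying by `a₂′` reduces this to `ratio-cross`.
    ratio-shift : b′ * a₂ + 1ℚ ≡ a₀ * a₃′ + a₄ * a₁′
    ratio-shift = *-cancelʳ-pos a₂′ a₂′>0 (begin
      (b′ * a₂ + 1ℚ) * a₂′                           ≡⟨ regroup b′ a₂ a₂′ ⟩
      (b′ * a₂′) * a₂ + a₂′                          ≡⟨ cong (λ t → t * a₂ + a₂′) b′-def ⟩
      (a₀′ * a₃′ + a₁′ * a₄′ + 1ℚ) * a₂ + a₂′        ≡⟨ ratio-cross ⟨
      (a₀ * a₃′ + a₄ * a₁′) * a₂′                    ∎)
      where
      open ≡-Reasoning
      regroup : ∀ b x y → (b * x + 1ℚ) * y ≡ (b * y) * x + y
      regroup = solve-∀ ℚ-ring

    -- Multiplied by `a₂`, both quotients become polynomial: `b` by its definition, `b′` by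
    -- `ratio-shift`. What is left is `a₄` times `e₁`, together with `e₂`.
    ratio-wronskian : b * a₃′ ≡ b′ * a₃ + a₄ + a₄′
    ratio-wronskian = *-cancelʳ-pos a₂ a₂>0 (+-cancel-≡
      (cong₂ _+_ (cong₂ _+_ (cong₂ _+_
        (cong (_* a₃′) (sym b-def)) (cong (_* a₃) ratio-shift)) (cong (a₄ *_) (sym e₁))) e₂)
      (identity a₀ a₁ a₁′ a₂ a₂′ a₃ a₃′ a₄ a₄′ b b′))
      where
      identity : ∀ a₀ a₁ a₁′ a₂ a₂′ a₃ a₃′ a₄ a₄′ b b′ →
        b * a₃′ * a₂
          + ((a₀ * a₃ + a₁ * a₄ + 1ℚ) * a₃′ + (b′ * a₂ + 1ℚ) * a₃
             + a₄ * (a₃ * a₁′ + a₂′ + a₂) + a₄′ * a₂)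
        ≡ (b′ * a₃ + a₄ + a₄′) * a₂
          + (b * a₂ * a₃′ + (a₀ * a₃′ + a₄ * a₁′) * a₃
             + a₄ * (a₃′ * a₁) + (a₄ * a₂′ + a₃′ + a₃))
      identity = solve-∀ ℚ-ring

    module _ {a₅ a₅′ c : ℚ} (a₃>0 : Positive a₃) (e₃ : a₅′ * a₃ ≡ a₅ * a₃′ + a₄′ + a₄) where

      -- By `e₃` and `ratio-wronskian`, `a₅` and `- b` have the same Wronskian against `a₃`. Hence
      -- `(a₅′ + b′) * a₃ ≡ (a₅ + b) * a₃′`, and the quotient by `a₃` is unchanged from n to n+1.
      quotient-step : a₅ + b ≡ c * a₃ → a₅′ + b′ ≡ c * a₃′
      quotient-step eq = *-cancelʳ-pos a₃ a₃>0 (+-cancel-≡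
        (cong₂ _+_ (cong₂ _+_ (sym e₃) ratio-wronskian) (cong (_* a₃′) (sym eq)))
        (identity a₃ a₃′ a₄ a₄′ a₅ a₅′ b b′ c))
        where
        identity : ∀ a₃ a₃′ a₄ a₄′ a₅ a₅′ b b′ c →
          (a₅′ + b′) * a₃ + ((a₅ * a₃′ + a₄′ + a₄) + b * a₃′ + c * a₃ * a₃′)
          ≡ c * a₃′ * a₃ + (a₅′ * a₃ + (b′ * a₃ + a₄ + a₄′) + (a₅ + b) * a₃′)
        identity = solve-∀ ℚ-ring

-- The linear recurrence with step K, and integrality from an initial window.

module Linearisation (K : ℕ) (y : ℕ → ℚ) (y>0 : ∀ n → Positive (y n))
  (y-rec : ∀ n → y (2 ℕ.* K ℕ.+ suc n) * y n
               ≡ y (2 ℕ.* K ℕ.+ n) * y (suc n) + y (1 ℕ.* K ℕ.+ suc n) + y (1 ℕ.* K ℕ.+ n))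
  where

  -- With a literal first argument, `Y 0 n` reduces to `y n` and `1 * K + n` matches `Y 1 n` without
  -- rewriting; this is why `1 * K` is written out in the recurrence.
  Y : ℕ → ℕ → ℚ
  Y i n = y (i ℕ.* K ℕ.+ n)

  Y-shift : ∀ j i n → Y j (i ℕ.* K ℕ.+ n) ≡ Y (j ℕ.+ i) n
  Y-shift j i n = cong y (trans (sym (ℕ.+-assoc (j ℕ.* K) _ n))
                                (cong (ℕ._+ n) (sym (ℕ.*-distribʳ-+ K j i))))

  Y-shift-suc : ∀ j i n → Y j (suc (i ℕ.* K ℕ.+ n)) ≡ Y (j ℕ.+ i) (suc n)
  Y-shift-suc j i n = trans (cong (Y j) (sym (ℕ.+-suc (i ℕ.* K) n))) (Y-shift j i (suc n))

  Y-rec : ∀ i n → Y (2 ℕ.+ i) (suc n) * Y i n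
                ≡ Y (2 ℕ.+ i) n * Y i (suc n) + Y (1 ℕ.+ i) (suc n) + Y (1 ℕ.+ i) n
  Y-rec i n = begin
    Y (2 ℕ.+ i) (suc n) * Y i n
      ≡⟨ cong (_* Y i n) (Y-shift-suc 2 i n) ⟨
    Y 2 (suc (i ℕ.* K ℕ.+ n)) * Y i n
      ≡⟨ y-rec (i ℕ.* K ℕ.+ n) ⟩
    Y 2 (i ℕ.* K ℕ.+ n) * y (suc (i ℕ.* K ℕ.+ n)) + Y 1 (suc (i ℕ.* K ℕ.+ n)) + Y 1 (i ℕ.* K ℕ.+ n)
      ≡⟨ cong₂ _+_ (cong₂ _+_ (cong₂ _*_ (Y-shift 2 i n) (Y-shift-suc 0 i n)) (Y-shift-suc 1 i n))
                   (Y-shift 1 i n) ⟩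
    Y (2 ℕ.+ i) n * Y i (suc n) + Y (1 ℕ.+ i) (suc n) + Y (1 ℕ.+ i) n ∎
    where open ≡-Reasoning

  numerator : ℕ → ℚ
  numerator n = Y 0 n * Y 3 n + Y 1 n * Y 4 n + 1ℚ

  -- The quantity B(n).
  ratio : ℕ → ℚ
  ratio n = numerator n * (1/ Y 2 n) {{pos⇒nonZero (Y 2 n) {{y>0 _}}}}

  ratio-* : ∀ n → ratio n * Y 2 n ≡ numerator n
  ratio-* n = begin
    numerator n * 1/ Y 2 n * Y 2 n    ≡⟨ *-assoc (numerator n) (1/ Y 2 n) (Y 2 n) ⟩
    numerator n * (1/ Y 2 n * Y 2 n)  ≡⟨ cong (numerator n *_) (*-inverseˡ (Y 2 n)) ⟩
    numerator n * 1ℚ                  ≡⟨ *-identityʳ (numerator n) ⟩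
    numerator n                       ∎
    where
    open ≡-Reasoning
    instance
      Y≢0 : NonZero (Y 2 n)
      Y≢0 = pos⇒nonZero (Y 2 n) {{y>0 _}}

  module _ {c : ℚ} (c-def : Y 5 0 + ratio 0 ≡ c * Y 3 0) where

    quotient-above : ∀ n → Y 5 n + ratio n ≡ c * Y 3 n
    quotient-above zero    = c-def
    quotient-above (suc n) = quotient-step
      {Y 0 n} {Y 0 (suc n)} {Y 1 n} {Y 1 (suc n)} {Y 2 n} {Y 2 (suc n)}
      {Y 3 n} {Y 3 (suc n)} {Y 4 n} {Y 4 (suc n)}
      (Y-rec 0 n) (Y-rec 1 n) (Y-rec 2 n)
      (y>0 _) (y>0 _) (ratio-* n) (ratio-* (suc n)) {Y 5 n} {Y 5 (suc n)} {c}
      (y>0 _) (Y-rec 3 n) (quotient-above n)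

    -- The numerators of B(n) and B(n+K) share `Y 1 n * Y 4 n + 1ℚ`. Equating the two expressions
    -- for it gives `Y 3 n` (`Y 0 n` + B(n+K)) = `Y 2 n` (`Y 5 n` + B(n)), and `quotient-above`
    -- applies to the right side.
    quotient-below : ∀ n → Y 0 n + ratio (1 ℕ.* K ℕ.+ n) ≡ c * Y 2 n
    quotient-below n = *-cancelʳ-pos (Y 3 n) (y>0 _) (+-cancel-≡
      (cong₂ _+_ (cong₂ _+_ (sym ratio-shifted) (ratio-* n)) (cong (Y 2 n *_) (sym (quotient-above n))))
      (identity (Y 0 n) (Y 1 n) (Y 2 n) (Y 3 n) (Y 4 n) (Y 5 n)
                (ratio n) (ratio (1 ℕ.* K ℕ.+ n)) c))
      where
      ratio-shifted : ratio (1 ℕ.* K ℕ.+ n) * Y 3 n ≡ Y 1 n * Y 4 n + Y 2 n * Y 5 n + 1ℚ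
      ratio-shifted = begin
        ratio (1 ℕ.* K ℕ.+ n) * Y 3 n
          ≡⟨ cong (ratio (1 ℕ.* K ℕ.+ n) *_) (Y-shift 2 1 n) ⟨
        ratio (1 ℕ.* K ℕ.+ n) * Y 2 (1 ℕ.* K ℕ.+ n)
          ≡⟨ ratio-* (1 ℕ.* K ℕ.+ n) ⟩
        numerator (1 ℕ.* K ℕ.+ n)
          ≡⟨ cong (_+ 1ℚ) (cong₂ _+_ (cong (Y 1 n *_) (Y-shift 3 1 n))
                                     (cong₂ _*_ (Y-shift 1 1 n) (Y-shift 4 1 n))) ⟩
        Y 1 n * Y 4 n + Y 2 n * Y 5 n + 1ℚ ∎
        where open ≡-Reasoning
      identity : ∀ y₀ y₁ y₂ y₃ y₄ y₅ r r₁ c →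
        (y₀ + r₁) * y₃ + ((y₁ * y₄ + y₂ * y₅ + 1ℚ) + r * y₂ + y₂ * (c * y₃))
        ≡ c * y₂ * y₃ + (r₁ * y₃ + (y₀ * y₃ + y₁ * y₄ + 1ℚ) + y₂ * (y₅ + r))
      identity = solve-∀ ℚ-ring

    -- `quotient-above` at n+K and `quotient-below` at n both contain B(n+K), which drops out.
    linear-recurrence : ∀ n → Y 6 n ≡ c * Y 4 n + Y 0 n + - (c * Y 2 n)
    linear-recurrence n = +-cancel-≡ (cong₂ _+_ above (quotient-below n))
      (identity (Y 0 n) (Y 2 n) (Y 4 n) (Y 6 n) (ratio (1 ℕ.* K ℕ.+ n)) c)
      where
      above : c * Y 4 n ≡ Y 6 n + ratio (1 ℕ.* K ℕ.+ n)
      above = begin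
        c * Y 4 n                                   ≡⟨ cong (c *_) (Y-shift 3 1 n) ⟨
        c * Y 3 (1 ℕ.* K ℕ.+ n)                     ≡⟨ quotient-above (1 ℕ.* K ℕ.+ n) ⟨
        Y 5 (1 ℕ.* K ℕ.+ n) + ratio (1 ℕ.* K ℕ.+ n) ≡⟨ cong (_+ ratio (1 ℕ.* K ℕ.+ n)) (Y-shift 5 1 n) ⟩
        Y 6 n + ratio (1 ℕ.* K ℕ.+ n)               ∎
        where open ≡-Reasoning
      identity : ∀ y₀ y₂ y₄ y₆ r c →
        y₆ + (c * y₄ + (y₀ + r)) ≡ c * y₄ + y₀ + - (c * y₂) + (y₆ + r + c * y₂)
      identity = solve-∀ ℚ-ring

  Y₂₀-Y₃₀-1⇒integral : 1 ≤ K → Y 2 0 ≡ 1ℚ → Y 3 0 ≡ 1ℚ →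
    (∀ m → m < 6 ℕ.* K → Integral (y m)) → ∀ m → Integral (y m)
  Y₂₀-Y₃₀-1⇒integral 1≤K Y₂₀≡1 Y₃₀≡1 initial = <-rec _ step
    where
    c : ℚ
    c = Y 5 0 + ratio 0

    ratio₀ : ratio 0 ≡ numerator 0
    ratio₀ = trans (sym (*-identityʳ (ratio 0)))
                   (trans (cong (ratio 0 *_) (sym Y₂₀≡1)) (ratio-* 0))

    c-def : Y 5 0 + ratio 0 ≡ c * Y 3 0
    c-def = trans (sym (*-identityʳ c)) (cong (c *_) (sym Y₃₀≡1))

    Y-< : ∀ {i} j n → i < j → i ℕ.* K ℕ.+ n < j ℕ.* K ℕ.+ n
    Y-< j n i<j = ℕ.+-monoˡ-< n (ℕ.*-monoˡ-< K {{ℕ.>-nonZero 1≤K}} i<j)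

    Y-initial : ∀ i → i < 6 → Integral (Y i 0)
    Y-initial i i<6 = initial _ (subst (i ℕ.* K ℕ.+ 0 <_) (ℕ.+-identityʳ (6 ℕ.* K)) (Y-< 6 0 i<6))

    c-integral : Integral c
    c-integral = integral-+ (Y-initial 5 (ℕ.≤ᵇ⇒≤ 6 6 _)) (subst Integral (sym ratio₀)
      (integral-+ (integral-+ (integral-* (Y-initial 0 (ℕ.≤ᵇ⇒≤ 1 6 _)) (Y-initial 3 (ℕ.≤ᵇ⇒≤ 4 6 _)))
                              (integral-* (Y-initial 1 (ℕ.≤ᵇ⇒≤ 2 6 _)) (Y-initial 4 (ℕ.≤ᵇ⇒≤ 5 6 _))))
                  integral-1))

    step : ∀ m → (∀ {l} → l < m → Integral (y l)) → Integral (y m)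
    step m IH with m ℕ.<? 6 ℕ.* K
    ... | yes m<6K = initial m m<6K
    ... | no  m≮6K with ℕ.m≤n⇒∃[o]m+o≡n (ℕ.≮⇒≥ m≮6K)
    ... | n , refl = subst Integral (sym (linear-recurrence {c} c-def n))
      (integral-+ (integral-+ (integral-* c-integral (IH (Y-< 6 n (ℕ.≤ᵇ⇒≤ 5 6 _))))
                              (IH (Y-< 6 n (ℕ.≤ᵇ⇒≤ 1 6 _))))
                  (integral-neg (integral-* c-integral (IH (Y-< 6 n (ℕ.≤ᵇ⇒≤ 3 6 _))))))

-- Reflection and the palindromic extension.

∣-∣-reflect : ∀ c m n → m ℕ.+ n ≡ c ℕ.+ c → ∣ m - c ∣ ≡ ∣ n - c ∣
∣-∣-reflect c m n eq = begin
  ∣ m - c ∣                      ≡⟨ ℕ.∣m+n-m+o∣≡∣n-o∣ n m c ⟨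
  ∣ n ℕ.+ m - n ℕ.+ c ∣          ≡⟨ cong₂ ∣_-_∣ (trans (ℕ.+-comm n m) eq) (ℕ.+-comm n c) ⟩
  ∣ c ℕ.+ c - c ℕ.+ n ∣          ≡⟨ ℕ.∣m+n-m+o∣≡∣n-o∣ c c n ⟩
  ∣ c - n ∣                      ≡⟨ ℕ.∣-∣-comm c n ⟩
  ∣ n - c ∣                      ∎
  where open ≡-Reasoning

module Extension (K : ℕ) (1≤K : 1 ≤ K) (b : ℕ → ℚ)
  (b-initial : ∀ j → j ≤ 2 ℕ.* K → b j ≡ 1ℚ)
  (b-rec : ∀ j → b (2 ℕ.* K ℕ.+ suc j) * b j
               ≡ b (2 ℕ.* K ℕ.+ j) * b (suc j) + b (1 ℕ.* K ℕ.+ suc j) + b (1 ℕ.* K ℕ.+ j))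
  where

  K+n<2K+n : ∀ n → 1 ℕ.* K ℕ.+ n < 2 ℕ.* K ℕ.+ n
  K+n<2K+n n = ℕ.+-monoˡ-< n (ℕ.*-monoˡ-< K {{ℕ.>-nonZero 1≤K}} (ℕ.n<1+n 1))

  -- Serves both positivity and integrality. The bound `N` restricts which divisors `b i` occur, so
  -- that integrality can be carried only as far as they equal 1.
  b-induction : (P : ℚ → Set) (N : ℕ) → P 1ℚ →
    (∀ i → i < N → P (b i) → P (b (suc i)) → P (b (1 ℕ.* K ℕ.+ i)) → P (b (1 ℕ.* K ℕ.+ suc i)) →
           P (b (2 ℕ.* K ℕ.+ i)) → P (b (2 ℕ.* K ℕ.+ suc i))) →
    ∀ j → j ≤ 2 ℕ.* K ℕ.+ N → P (b j)
  b-induction P N P1 P-step = <-rec _ step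
    where
    step : ∀ j → (∀ {l} → l < j → l ≤ 2 ℕ.* K ℕ.+ N → P (b l)) →
      j ≤ 2 ℕ.* K ℕ.+ N → P (b j)
    step j IH j≤ with j ℕ.≤? 2 ℕ.* K
    ... | yes j≤2K = subst P (sym (b-initial j j≤2K)) P1
    ... | no  j≰2K with ℕ.m≤n⇒∃[o]m+o≡n (ℕ.≰⇒> j≰2K)
    ... | i , refl = subst (P ∘ b) (ℕ.+-suc (2 ℕ.* K) i)
      (P-step i (ℕ.+-cancelˡ-≤ (2 ℕ.* K) _ _ (ℕ.≤-trans (ℕ.≤-reflexive (ℕ.+-suc (2 ℕ.* K) i)) j≤))
        (IH′ (ℕ.<-trans (ℕ.n<1+n i) suc-i<))
        (IH′ suc-i<)
        (IH′ (ℕ.<-trans (ℕ.+-monoʳ-< (1 ℕ.* K) (ℕ.n<1+n i)) (K+n<2K+n (suc i))))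
        (IH′ (K+n<2K+n (suc i)))
        (IH′ (ℕ.+-monoʳ-< (2 ℕ.* K) (ℕ.n<1+n i))))
      where
      suc-i< : suc i < 2 ℕ.* K ℕ.+ suc i
      suc-i< = ℕ.≤-<-trans (ℕ.m≤n+m (suc i) (1 ℕ.* K)) (K+n<2K+n (suc i))

      IH′ : ∀ {l} → l < 2 ℕ.* K ℕ.+ suc i → P (b l)
      IH′ {l} l< = IH l<j (ℕ.≤-trans (ℕ.<⇒≤ l<j) j≤)
        where
        l<j : l < suc (2 ℕ.* K) ℕ.+ i
        l<j = subst (l <_) (ℕ.+-suc (2 ℕ.* K) i) l<

  b-positive : ∀ j → Positive (b j)
  -- Choosing `N` as `j` brings the arbitrary index `j` within range.
  b-positive j = b-induction Positive j _ step j (ℕ.m≤n+m j _)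
    where
    step : ∀ i → i < j → Positive (b i) → Positive (b (suc i)) →
      Positive (b (1 ℕ.* K ℕ.+ i)) → Positive (b (1 ℕ.* K ℕ.+ suc i)) →
      Positive (b (2 ℕ.* K ℕ.+ i)) → Positive (b (2 ℕ.* K ℕ.+ suc i))
    step i _ b₀ b₀′ b₁ b₁′ b₂ = pos-*-cancelʳ (b (2 ℕ.* K ℕ.+ suc i)) (b i) b₀
      (subst Positive (sym (b-rec i)) rhs>0)
      where
      u = b (2 ℕ.* K ℕ.+ i) * b (suc i)
      v = b (1 ℕ.* K ℕ.+ suc i)
      w = b (1 ℕ.* K ℕ.+ i)
      u>0 : Positive u
      u>0 = pos*pos⇒pos (b (2 ℕ.* K ℕ.+ i)) {{b₂}} (b (suc i)) {{b₀′}}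
      rhs>0 : Positive (u + v + w)
      rhs>0 = pos+pos⇒pos (u + v) {{pos+pos⇒pos u {{u>0}} v {{b₁′}}}} w {{b₁}}

  -- For `i < 2K` the divisor `b i` is 1, so the recurrence gives the new term as a polynomial in
  -- earlier ones. The range up to 4K is what the window of `y` around 3K reaches.
  b-integral : ∀ j → j ≤ 2 ℕ.* K ℕ.+ 2 ℕ.* K → Integral (b j)
  b-integral = b-induction Integral (2 ℕ.* K) integral-1
    (λ i i<2K p q r s t → subst Integral (begin
      b (2 ℕ.* K ℕ.+ i) * b (suc i) + b (1 ℕ.* K ℕ.+ suc i) + b (1 ℕ.* K ℕ.+ i)
        ≡⟨ b-rec i ⟨
      b (2 ℕ.* K ℕ.+ suc i) * b i
        ≡⟨ cong (b (2 ℕ.* K ℕ.+ suc i) *_) (b-initial i (ℕ.<⇒≤ i<2K)) ⟩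
      b (2 ℕ.* K ℕ.+ suc i) * 1ℚ
        ≡⟨ *-identityʳ _ ⟩
      b (2 ℕ.* K ℕ.+ suc i) ∎)
      (integral-+ (integral-+ (integral-* t q) s) r))
    where open ≡-Reasoning

  -- The palindromic extension: its indices are shifted by 2K relative to b, so
  -- the block of ones is y(2K), …, y(4K), centred at 3K.
  y : ℕ → ℚ
  y m = b (K ℕ.+ ∣ m - 3 ℕ.* K ∣)

  y-reflect : ∀ m n → m ℕ.+ n ≡ 6 ℕ.* K → y m ≡ y n
  y-reflect m n eq = cong (b ∘ (K ℕ.+_))
    (∣-∣-reflect (3 ℕ.* K) m n (trans eq (ℕ.*-distribʳ-+ K 3 3)))

  distance-shift : ∀ j → ∣ 2 ℕ.* K ℕ.+ j - 3 ℕ.* K ∣ ≡ ∣ j - K ∣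
  distance-shift j = trans (cong (∣ 2 ℕ.* K ℕ.+ j -_∣) (ℕ.+-comm K (2 ℕ.* K)))
                           (ℕ.∣m+n-m+o∣≡∣n-o∣ (2 ℕ.* K) j K)

  -- For `K ≤ j` the indices agree. For `j ≤ K` they may differ, but both lie in the block of ones.
  y-extends : ∀ {m} j → m ≡ 2 ℕ.* K ℕ.+ j → y m ≡ b j
  y-extends j refl with ℕ.≤-total K j
  ... | inj₁ K≤j = cong b (begin
    K ℕ.+ ∣ 2 ℕ.* K ℕ.+ j - 3 ℕ.* K ∣        ≡⟨ cong (K ℕ.+_) (distance-shift j) ⟩
    K ℕ.+ ∣ j - K ∣                          ≡⟨ cong (K ℕ.+_) (ℕ.m≤n⇒∣n-m∣≡n∸m K≤j) ⟩
    K ℕ.+ (j ∸ K)                            ≡⟨ ℕ.m+[n∸m]≡n K≤j ⟩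
    j                                        ∎)
    where
    open ≡-Reasoning
  ... | inj₂ j≤K = trans (b-initial _ bound) (sym (b-initial j (ℕ.≤-trans j≤K (ℕ.m≤m+n K _))))
    where
    bound : K ℕ.+ ∣ 2 ℕ.* K ℕ.+ j - 3 ℕ.* K ∣ ≤ 2 ℕ.* K
    bound = ℕ.+-monoʳ-≤ K (begin
      ∣ 2 ℕ.* K ℕ.+ j - 3 ℕ.* K ∣            ≡⟨ distance-shift j ⟩
      ∣ j - K ∣                              ≡⟨ ℕ.m≤n⇒∣m-n∣≡n∸m j≤K ⟩
      K ∸ j                                  ≤⟨ ℕ.m∸n≤m K j ⟩
      K                                      ≤⟨ ℕ.m≤m+n K 0 ⟩
      1 ℕ.* K                                ∎)
      where open ℕ.≤-Reasoning

  y-rec-right : ∀ j → let n = 2 ℕ.* K ℕ.+ j in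
    y (2 ℕ.* K ℕ.+ suc n) * y n ≡ y (2 ℕ.* K ℕ.+ n) * y (suc n) + y (1 ℕ.* K ℕ.+ suc n) + y (1 ℕ.* K ℕ.+ n)
  y-rec-right j = trans
    (cong₂ _*_ (y-extends (2 ℕ.* K ℕ.+ suc j) (cong (2 ℕ.* K ℕ.+_) (sym (ℕ.+-suc _ j)))) (y-extends j refl))
    (trans (b-rec j) (sym (cong₂ _+_ (cong₂ _+_ (cong₂ _*_
      (y-extends (2 ℕ.* K ℕ.+ j) refl)
      (y-extends (suc j) (sym (ℕ.+-suc _ j))))
      (y-extends (1 ℕ.* K ℕ.+ suc j) (eq₁ K j)))
      (y-extends (1 ℕ.* K ℕ.+ j) (eq₂ K j)))))
    where
    eq₁ : ∀ k j → 1 ℕ.* k ℕ.+ suc (2 ℕ.* k ℕ.+ j) ≡ 2 ℕ.* k ℕ.+ (1 ℕ.* k ℕ.+ suc j)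
    eq₁ = ℕ-Solver.solve-∀
    eq₂ : ∀ k j → 1 ℕ.* k ℕ.+ (2 ℕ.* k ℕ.+ j) ≡ 2 ℕ.* k ℕ.+ (1 ℕ.* k ℕ.+ j)
    eq₂ = ℕ-Solver.solve-∀

  -- For `n < 2K` the reflection of m to 6K - m carries the relation at `n` to one at an index of at
  -- least 2K, with the factors and summands interchanged.
  y-rec : ∀ n →
    y (2 ℕ.* K ℕ.+ suc n) * y n ≡ y (2 ℕ.* K ℕ.+ n) * y (suc n) + y (1 ℕ.* K ℕ.+ suc n) + y (1 ℕ.* K ℕ.+ n)
  y-rec n with 2 ℕ.* K ℕ.≤? n
  ... | yes 2K≤n with ℕ.m≤n⇒∃[o]m+o≡n 2K≤n
  ...   | j , refl = y-rec-right j
  y-rec n | no 2K≰n with ℕ.m≤n⇒∃[o]m+o≡n (ℕ.≰⇒> 2K≰n)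
  ...   | i , eq = begin
    y (2 ℕ.* K ℕ.+ suc n) * y n
      ≡⟨ cong₂ _*_ (reflect (2 ℕ.* K ℕ.+ suc n) p (i₁ K n i)) (reflect n _ (i₂ K n i)) ⟩
    y p * y (2 ℕ.* K ℕ.+ suc p)
      ≡⟨ *-comm (y p) _ ⟩
    y (2 ℕ.* K ℕ.+ suc p) * y p
      ≡⟨ y-rec-right i ⟩
    y (2 ℕ.* K ℕ.+ p) * y (suc p) + y (1 ℕ.* K ℕ.+ suc p) + y (1 ℕ.* K ℕ.+ p)
      ≡⟨ swap (y (2 ℕ.* K ℕ.+ p)) (y (suc p)) (y (1 ℕ.* K ℕ.+ suc p)) (y (1 ℕ.* K ℕ.+ p)) ⟩
    y (suc p) * y (2 ℕ.* K ℕ.+ p) + y (1 ℕ.* K ℕ.+ p) + y (1 ℕ.* K ℕ.+ suc p)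
      ≡⟨ cong₂ _+_ (cong₂ _+_ (cong₂ _*_ (reflect (2 ℕ.* K ℕ.+ n) (suc p) (i₃ K n i)) (reflect (suc n) _ (i₄ K n i)))
                   (reflect (1 ℕ.* K ℕ.+ suc n) _ (i₅ K n i))) (reflect (1 ℕ.* K ℕ.+ n) _ (i₆ K n i)) ⟨
    y (2 ℕ.* K ℕ.+ n) * y (suc n) + y (1 ℕ.* K ℕ.+ suc n) + y (1 ℕ.* K ℕ.+ n) ∎
    where
    open ≡-Reasoning
    -- Since `suc n + i` is 2K, `p` is 6K - (n + 2K + 1), the mirror image of the top index.
    p = 2 ℕ.* K ℕ.+ i
    reflect : ∀ m m′ → m ℕ.+ m′ ≡ 4 ℕ.* K ℕ.+ (suc n ℕ.+ i) → y m ≡ y m′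
    reflect m m′ m+m′≡ = y-reflect m m′ (trans m+m′≡
      (trans (cong (4 ℕ.* K ℕ.+_) eq) (sym (ℕ.*-distribʳ-+ K 4 2))))
    i₁ : ∀ k n i → (2 ℕ.* k ℕ.+ suc n) ℕ.+ (2 ℕ.* k ℕ.+ i) ≡ 4 ℕ.* k ℕ.+ (suc n ℕ.+ i)
    i₁ = ℕ-Solver.solve-∀
    i₂ : ∀ k n i → n ℕ.+ (2 ℕ.* k ℕ.+ suc (2 ℕ.* k ℕ.+ i)) ≡ 4 ℕ.* k ℕ.+ (suc n ℕ.+ i)
    i₂ = ℕ-Solver.solve-∀
    i₃ : ∀ k n i → (2 ℕ.* k ℕ.+ n) ℕ.+ suc (2 ℕ.* k ℕ.+ i) ≡ 4 ℕ.* k ℕ.+ (suc n ℕ.+ i)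
    i₃ = ℕ-Solver.solve-∀
    i₄ : ∀ k n i → suc n ℕ.+ (2 ℕ.* k ℕ.+ (2 ℕ.* k ℕ.+ i)) ≡ 4 ℕ.* k ℕ.+ (suc n ℕ.+ i)
    i₄ = ℕ-Solver.solve-∀
    i₅ : ∀ k n i → (1 ℕ.* k ℕ.+ suc n) ℕ.+ (1 ℕ.* k ℕ.+ (2 ℕ.* k ℕ.+ i)) ≡ 4 ℕ.* k ℕ.+ (suc n ℕ.+ i)
    i₅ = ℕ-Solver.solve-∀
    i₆ : ∀ k n i → (1 ℕ.* k ℕ.+ n) ℕ.+ (1 ℕ.* k ℕ.+ suc (2 ℕ.* k ℕ.+ i)) ≡ 4 ℕ.* k ℕ.+ (suc n ℕ.+ i)
    i₆ = ℕ-Solver.solve-∀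
    swap : ∀ u v s t → u * v + s + t ≡ v * u + t + s
    swap = solve-∀ ℚ-ring

  y-initial-integral : ∀ m → m < 6 ℕ.* K → Integral (y m)
  y-initial-integral m m<6K = b-integral _ (ℕ.≤-trans (ℕ.+-monoʳ-≤ K distance≤)
    (ℕ.≤-reflexive (ℕ.*-distribʳ-+ K 2 2)))
    where
    distance≤ : ∣ m - 3 ℕ.* K ∣ ≤ 3 ℕ.* K
    distance≤ with ℕ.≤-total m (3 ℕ.* K)
    ... | inj₁ m≤3K = ℕ.≤-trans (ℕ.≤-reflexive (ℕ.m≤n⇒∣m-n∣≡n∸m m≤3K)) (ℕ.m∸n≤m (3 ℕ.* K) m)
    ... | inj₂ 3K≤m = ℕ.≤-trans (ℕ.≤-reflexive (ℕ.m≤n⇒∣n-m∣≡n∸m 3K≤m))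
      (ℕ.m≤n+o⇒m∸n≤o m (3 ℕ.* K) (ℕ.≤-trans (ℕ.<⇒≤ m<6K) (ℕ.≤-reflexive (ℕ.*-distribʳ-+ K 3 3))))

  all-integral : ∀ j → Integral (b j)
  all-integral j = subst Integral (y-extends j refl)
    (Y₂₀-Y₃₀-1⇒integral 1≤K
      -- The positions 2K and 3K are the left end and the centre of the block of ones.
      (trans (y-extends 0 refl) (b-initial 0 z≤n))
      (trans (y-extends (1 ℕ.* K) (eq K)) (b-initial (1 ℕ.* K) (ℕ.*-monoˡ-≤ K (ℕ.n≤1+n 1))))
      y-initial-integral (2 ℕ.* K ℕ.+ j))
    where
    open Linearisation K y (λ _ → b-positive _) y-rec
    eq : ∀ k → 3 ℕ.* k ℕ.+ 0 ≡ 2 ℕ.* k ℕ.+ 1 ℕ.* k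
    eq = ℕ-Solver.solve-∀

theorem1 : ∀ (K : ℕ) → 1 ≤ K → ∀ (a : ℕ → ℚ) → IsRecurrenceSequence K a →
    ∀ (n : ℕ) → 1 ≤ n → ∃[ z ] a n ≡ z / 1
-- Composing with `suc` moves the block of ones to the indices 0 to 2K.
theorem1 K 1≤K a isRec (suc j) _ = Extension.all-integral K 1≤K (a ∘ suc) initial′ recurrence′ j
  where
  open IsRecurrenceSequence isRec

  initial′ : ∀ j → j ≤ 2 ℕ.* K → a (suc j) ≡ 1ℚ
  initial′ j j≤2K = initial (suc j) (s≤s z≤n) (ℕ.≤-trans (s≤s j≤2K) (ℕ.≤-reflexive (ℕ.+-comm 1 _)))

  recurrence′ : ∀ j → a (suc (2 ℕ.* K ℕ.+ suc j)) * a (suc j)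
    ≡ a (suc (2 ℕ.* K ℕ.+ j)) * a (suc (suc j)) + a (suc (1 ℕ.* K ℕ.+ suc j)) + a (suc (1 ℕ.* K ℕ.+ j))
  recurrence′ j = begin
    a n * a (suc j)
      ≡⟨ cong (λ m → a n * a m) (∸-lemma (2 ℕ.* K ℕ.+ 1) (suc j) (i₁ K j)) ⟨
    a n * a (n ∸ (2 ℕ.* K ℕ.+ 1))
      ≡⟨ recurrence n (ℕ.≤-trans (ℕ.m≤m+n _ j) (ℕ.≤-reflexive (i₂ K j))) ⟩
    a (n ∸ 1) * a (n ∸ 2 ℕ.* K) + a (n ∸ K) + a (n ∸ K ∸ 1)
      ≡⟨ cong₂ _+_ (cong₂ _+_ (cong₂ (λ l m → a l * a m)
           (ℕ.+-suc (2 ℕ.* K) j) (∸-lemma (2 ℕ.* K) (suc (suc j)) (i₃ K j)))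
           (cong a n∸K)) (cong a (trans (cong (_∸ 1) n∸K) (ℕ.+-suc (1 ℕ.* K) j))) ⟩
    a (suc (2 ℕ.* K ℕ.+ j)) * a (suc (suc j)) + a (suc (1 ℕ.* K ℕ.+ suc j)) + a (suc (1 ℕ.* K ℕ.+ j)) ∎
    where
    open ≡-Reasoning
    -- This equals 2K + 2 + j, so `j = 0` is the first index at which the recurrence is given.
    n = suc (2 ℕ.* K ℕ.+ suc j)
    ∸-lemma : ∀ {m} k l → m ≡ k ℕ.+ l → m ∸ k ≡ l
    ∸-lemma k l refl = ℕ.m+n∸m≡n k l
    i₁ : ∀ k j → suc (2 ℕ.* k ℕ.+ suc j) ≡ (2 ℕ.* k ℕ.+ 1) ℕ.+ suc j
    i₁ = ℕ-Solver.solve-∀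
    i₂ : ∀ k j → 2 ℕ.* k ℕ.+ 2 ℕ.+ j ≡ suc (2 ℕ.* k ℕ.+ suc j)
    i₂ = ℕ-Solver.solve-∀
    i₃ : ∀ k j → suc (2 ℕ.* k ℕ.+ suc j) ≡ 2 ℕ.* k ℕ.+ suc (suc j)
    i₃ = ℕ-Solver.solve-∀
    i₄ : ∀ k j → suc (2 ℕ.* k ℕ.+ suc j) ≡ k ℕ.+ suc (1 ℕ.* k ℕ.+ suc j)
    i₄ = ℕ-Solver.solve-∀
    n∸K : n ∸ K ≡ suc (1 ℕ.* K ℕ.+ suc j)
    n∸K = ∸-lemma K _ (i₄ K j)
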